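{- Let $q$ be an odd prime power and let $\gamma\in\mathbb{F}_{q^2}$. The polynomial $f(x)=x+\gamma\,\mathrm{Tr}(x^2)$ over $\mathbb{F}_{q^2}$ is a permutation polynomial if and only if $\gamma=0$. Consequently, for $H(x)=x^2$ the set $P_H=\{\gamma\in\mathbb{F}_{q^2}: x+\gamma\,\mathrm{Tr}(H(x))\text{ is a permutation polynomial over }\mathbb{F}_{q^2}\}$ equals $\{0\}$.
   Context: $\mathrm{Tr}:\mathbb{F}_{q^2}\to\mathbb{F}_q$ is the trace map $\mathrm{Tr}(x)=x+x^q$. A polynomial $f$ over $\mathbb{F}_{q^2}$ is a permutation polynomial if the map $x\mapsto f(x)$ is a bijection of $\mathbb{F}_{q^2}$ onto itself. -}

module Defs where

open import Level using (Level; _⊔_)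
open import Algebra.Apartness.Bundles using (HeytingCommutativeRing; HeytingField)
open import Algebra.Bundles using (CommutativeRing; Semiring)
import Algebra.Definitions.RawSemiring as RawSemiringDefinitions
open import Data.Fin using (Fin)
open import Data.List using (List; []; _∷_; map)
open import Data.Nat as ℕ using (ℕ; zero; suc)
open import Data.Nat.Divisibility using (_∤_)
open import Data.Nat.Primality using (Prime)
open import Data.Product using (_×_; ∃₂)
open import Function.Bundles using (Inverse)
open import Function.Definitions using (Bijective)
open import Relation.Binary.PropositionalEquality as ≡ using (_≡_)
import Relation.Binary.Reasoning.Setoid as SetoidReasoning
open import Relation.Unary using (Pred)

IsPrimePower : ℕ → Set
IsPrimePower q = ∃₂ λ p k → Prime p × 1 ℕ.≤ k × q ≡ p ℕ.^ k

IsOddPrimePower : ℕ → Set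
IsOddPrimePower q = IsPrimePower q × 2 ∤ q

-- On a finite carrier _≈_ is decidable, so tightness of _#_ makes every
-- nonzero element invertible: a Heyting field of finite order is an ordinary
-- finite field, and conversely every finite field is one with _#_ = _≉_.
HasOrder : ∀ {c ℓ₁ ℓ₂} → HeytingField c ℓ₁ ℓ₂ → ℕ → Set (c ⊔ ℓ₁)
HasOrder F n = Inverse (HeytingField.setoid F) (≡.setoid (Fin n))

module Polynomials {c ℓ} (R : CommutativeRing c ℓ) where

  open CommutativeRing R
  open RawSemiringDefinitions (Semiring.rawSemiring semiring) public using (_^_)

  infixl 6 _+ₚ_
  infixl 7 _*ₚ_ _∙ₚ_
  infixr 8 _^ₚ_

  -- Coefficients with the constant term first; trailing zeros are allowed.
  Poly : Set c
  Poly = List Carrier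

  eval : Poly → Carrier → Carrier
  eval []      x = 0#
  eval (a ∷ f) x = a + x * eval f x

  X : Poly
  X = 0# ∷ 1# ∷ []

  _+ₚ_ : Poly → Poly → Poly
  []      +ₚ g       = g
  (a ∷ f) +ₚ []      = a ∷ f
  (a ∷ f) +ₚ (b ∷ g) = a + b ∷ f +ₚ g

  _∙ₚ_ : Carrier → Poly → Poly
  c ∙ₚ f = map (c *_) f

  _*ₚ_ : Poly → Poly → Poly
  []      *ₚ g = []
  (a ∷ f) *ₚ g = (a ∙ₚ g) +ₚ (0# ∷ f *ₚ g)

  _^ₚ_ : Poly → ℕ → Poly
  f ^ₚ zero  = 1# ∷ []
  f ^ₚ suc n = f *ₚ f ^ₚ n

  IsPermutationPolynomial : Poly → Set (c ⊔ ℓ)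
  IsPermutationPolynomial f = Bijective _≈_ _≈_ (eval f)

  private
    open SetoidReasoning setoid
    open import Algebra.Properties.CommutativeSemigroup +-commutativeSemigroup
      using () renaming (interchange to +-interchange)
    open import Algebra.Properties.CommutativeSemigroup *-commutativeSemigroup
      using (x∙yz≈y∙xz)

  eval-X : ∀ x → eval X x ≈ x
  eval-X x = begin
    0# + x * (1# + x * 0#)  ≈⟨ +-identityˡ _ ⟩
    x * (1# + x * 0#)       ≈⟨ *-congˡ (+-congˡ (zeroʳ x)) ⟩
    x * (1# + 0#)           ≈⟨ *-congˡ (+-identityʳ 1#) ⟩
    x * 1#                  ≈⟨ *-identityʳ x ⟩
    x                       ∎

  eval-+ : ∀ f g x → eval (f +ₚ g) x ≈ eval f x + eval g x
  eval-+ []      g       x = sym (+-identityˡ _)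
  eval-+ (a ∷ f) []      x = sym (+-identityʳ _)
  eval-+ (a ∷ f) (b ∷ g) x = begin
    (a + b) + x * eval (f +ₚ g) x             ≈⟨ +-congˡ (*-congˡ (eval-+ f g x)) ⟩
    (a + b) + x * (eval f x + eval g x)       ≈⟨ +-congˡ (distribˡ x _ _) ⟩
    (a + b) + (x * eval f x + x * eval g x)   ≈⟨ +-interchange a b _ _ ⟩
    (a + x * eval f x) + (b + x * eval g x)   ∎

  eval-∙ : ∀ c f x → eval (c ∙ₚ f) x ≈ c * eval f x
  eval-∙ c []      x = sym (zeroʳ c)
  eval-∙ c (a ∷ f) x = begin
    c * a + x * eval (c ∙ₚ f) x   ≈⟨ +-congˡ (*-congˡ (eval-∙ c f x)) ⟩
    c * a + x * (c * eval f x)    ≈⟨ +-congˡ (x∙yz≈y∙xz x c _) ⟩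
    c * a + c * (x * eval f x)    ≈⟨ distribˡ c a _ ⟨
    c * (a + x * eval f x)        ∎

  eval-* : ∀ f g x → eval (f *ₚ g) x ≈ eval f x * eval g x
  eval-* []      g x = sym (zeroˡ _)
  eval-* (a ∷ f) g x = begin
    eval ((a ∙ₚ g) +ₚ (0# ∷ f *ₚ g)) x              ≈⟨ eval-+ (a ∙ₚ g) (0# ∷ f *ₚ g) x ⟩
    eval (a ∙ₚ g) x + (0# + x * eval (f *ₚ g) x)    ≈⟨ +-cong (eval-∙ a g x) (+-identityˡ _) ⟩
    a * eval g x + x * eval (f *ₚ g) x              ≈⟨ +-congˡ (*-congˡ (eval-* f g x)) ⟩
    a * eval g x + x * (eval f x * eval g x)        ≈⟨ +-congˡ (*-assoc x _ _) ⟨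
    a * eval g x + (x * eval f x) * eval g x        ≈⟨ distribʳ _ a _ ⟨
    (a + x * eval f x) * eval g x                   ∎

  eval-^ : ∀ f n x → eval (f ^ₚ n) x ≈ eval f x ^ n
  eval-^ f zero    x = trans (+-congˡ (zeroʳ x)) (+-identityʳ 1#)
  eval-^ f (suc n) x = trans (eval-* f (f ^ₚ n) x) (*-congˡ (eval-^ f n x))

module TraceOver {c ℓ₁ ℓ₂} (F : HeytingField c ℓ₁ ℓ₂) (q : ℕ) where

  open HeytingField F
  open Polynomials
    (HeytingCommutativeRing.commutativeRing heytingCommutativeRing) public

  -- When F has q² elements the values lie in the subfield { a | a ^ q ≈ a }
  -- of order q; they are kept as elements of F.
  Tr : Carrier → Carrier
  Tr x = x + x ^ q

  -- The polynomial Tr(H(x)) = H(x) + H(x)^q.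
  Trₚ : Poly → Poly
  Trₚ H = H +ₚ H ^ₚ q

  eval-Tr : ∀ H x → eval (Trₚ H) x ≈ Tr (eval H x)
  eval-Tr H x = trans (eval-+ H (H ^ₚ q) x) (+-congˡ (eval-^ H q x))

  P : Poly → Pred Carrier (c ⊔ ℓ₁)
  P H γ = IsPermutationPolynomial (X +ₚ γ ∙ₚ Trₚ H)

  -- ｛ a ｝ of Relation.Unary is formed with _≡_; here equality in F is _≈_.
  ⟦_⟧ : Carrier → Pred Carrier ℓ₁
  ⟦ a ⟧ x = x ≈ a

{-# OPTIONS --safe #-}

-- The difference f(y + γ) − f(y) equals γ (1 + Tr((y + γ)² − y²)).  Write
-- q = 2m + 1.  The element h = m · 1 of the prime field satisfies 2h = −1, so
-- Tr(h) = h + h^q = 2h = −1.  If γ ≠ 0 we can solve (y + γ)² = y² + h for y, and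
-- then y and y + γ are distinct points with the same image under f.

module Submission where

open import Defs
open import Algebra.Apartness.Bundles using (HeytingCommutativeRing; HeytingField)
open import Algebra.Bundles
  using (AbelianGroup; CommutativeSemiring; CommutativeRing)
open import Data.Fin.Base as Fin using (Fin; inject₁; fromℕ)
open import Data.Fin.Permutation using (Permutation′; permutation)
import Data.Fin.Properties as Fin
open import Data.Nat.Base as ℕ using (ℕ; zero; suc; s≤s; s<s; z<s)
open import Data.Nat.Combinatorics
  using (_C_; nC1≡n; nCn≡1; k>n⇒nCk≡0; nCk+nC[k+1]≡[n+1]C[k+1])
open import Data.Nat.Divisibility using (_∣_; _∤_; divides-refl; >⇒∤; m∣m*n; m%n≡0⇒n∣m)
open import Data.Nat.DivMod using (_/_; _%_; m%n<n; m≡m%n+[m/n]*n)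
open import Data.Nat.Primality using (Prime; euclidsLemma; ¬prime[0])
import Data.Nat.Properties as ℕ
open import Data.Nat.Solver using (module +-*-Solver)
open import Data.Product.Base using (∃; _,_; proj₁; proj₂)
open import Data.Sum.Base using (inj₁; inj₂)
open import Function.Base using (_∘_)
open import Function.Bundles using (Inverse; mk⇔)
open import Relation.Binary.PropositionalEquality as ≡ using (_≡_)
import Relation.Binary.Reasoning.Setoid as SetoidReasoning
open import Relation.Nullary.Negation using (contradiction)

-- Prime divisors of binomial coefficients, and odd numbers.

[1+k]*[1+n]C[1+k]≡[1+n]*nCk : ∀ n k → suc k ℕ.* (suc n C suc k) ≡ suc n ℕ.* (n C k)
[1+k]*[1+n]C[1+k]≡[1+n]*nCk n zero = begin
  1 ℕ.* (suc n C 1)  ≡⟨ ℕ.*-identityˡ _ ⟩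
  suc n C 1          ≡⟨ nC1≡n (suc n) ⟩
  suc n              ≡⟨ ℕ.*-identityʳ _ ⟨
  suc n ℕ.* 1        ∎
  where open ≡.≡-Reasoning
[1+k]*[1+n]C[1+k]≡[1+n]*nCk zero (suc k) = begin
  suc (suc k) ℕ.* (1 C suc (suc k))  ≡⟨ ≡.cong (suc (suc k) ℕ.*_) (k>n⇒nCk≡0 (s<s (z<s {k}))) ⟩
  suc (suc k) ℕ.* 0                  ≡⟨ ℕ.*-zeroʳ (suc (suc k)) ⟩
  0                                  ≡⟨ ≡.cong (1 ℕ.*_) (k>n⇒nCk≡0 (z<s {k})) ⟨
  1 ℕ.* (0 C suc k)                  ∎
  where open ≡.≡-Reasoning
[1+k]*[1+n]C[1+k]≡[1+n]*nCk (suc n) (suc k) = begin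
  suc (suc k) ℕ.* (suc (suc n) C suc (suc k))
    ≡⟨ ≡.cong (suc (suc k) ℕ.*_) (nCk+nC[k+1]≡[n+1]C[k+1] (suc n) (suc k)) ⟨
  suc (suc k) ℕ.* (a ℕ.+ b)
    -- After Pascal's rule, one copy of `a` is set aside so that the other two summands match the
    -- induction hypotheses; it is absorbed again at the end, raising `suc n` to `suc (suc n)`.
    ≡⟨ solve 3 (λ k a b → (con 2 :+ k) :* (a :+ b) := a :+ ((con 1 :+ k) :* a :+ (con 2 :+ k) :* b))
         ≡.refl k a b ⟩
  a ℕ.+ (suc k ℕ.* a ℕ.+ suc (suc k) ℕ.* b)
    ≡⟨ ≡.cong (a ℕ.+_) (≡.cong₂ ℕ._+_ ([1+k]*[1+n]C[1+k]≡[1+n]*nCk n k)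
                                       ([1+k]*[1+n]C[1+k]≡[1+n]*nCk n (suc k))) ⟩
  a ℕ.+ (suc n ℕ.* (n C k) ℕ.+ suc n ℕ.* (n C suc k))
    ≡⟨ ≡.cong (a ℕ.+_) (ℕ.*-distribˡ-+ (suc n) (n C k) (n C suc k)) ⟨
  a ℕ.+ suc n ℕ.* (n C k ℕ.+ n C suc k)
    ≡⟨ ≡.cong (λ c → a ℕ.+ suc n ℕ.* c) (nCk+nC[k+1]≡[n+1]C[k+1] n k) ⟩
  suc (suc n) ℕ.* a  ∎
  where
  open ≡.≡-Reasoning
  open +-*-Solver
  a = suc n C suc k
  b = suc n C suc (suc k)

-- By the absorption identity `p` divides `k` times `p C k`. It cannot divide `k`, which is positive
-- and smaller, so Euclid's lemma leaves the coefficient.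
prime⇒p∣pCk : ∀ {p k} → Prime p → 0 ℕ.< k → k ℕ.< p → p ∣ p C k
prime⇒p∣pCk {suc n} {suc k} p-prime _ k<p
  with euclidsLemma (suc k) (suc n C suc k) p-prime
         (≡.subst (suc n ∣_) (≡.sym ([1+k]*[1+n]C[1+k]≡[1+n]*nCk n k)) (m∣m*n (n C k)))
... | inj₁ p∣k = contradiction p∣k (>⇒∤ k<p)
... | inj₂ p∣C = p∣C

2∤n⇒n≡1+m+m : ∀ {n} → 2 ∤ n → ∃ λ m → n ≡ suc (m ℕ.+ m)
2∤n⇒n≡1+m+m {n} 2∤n with n % 2 in eq | m%n<n n 2 | m≡m%n+[m/n]*n n 2
... | 0 | _ | _ = contradiction (m%n≡0⇒n∣m n 2 eq) 2∤n
... | 1 | _ | n≡ = n / 2 ,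
  ≡.trans n≡ (≡.cong suc (solve 1 (λ m → m :* con 2 := m :+ m) ≡.refl (n / 2)))
  where open +-*-Solver
... | suc (suc _) | s≤s (s≤s ()) | _

-- Finite abelian groups are annihilated by their order.

module _ {a ℓ} (G : AbelianGroup a ℓ) where

  open AbelianGroup G
  open import Algebra.Properties.Group group
    using (//-rightDividesˡ; //-rightDividesʳ; identityʳ-unique)
  open import Algebra.Properties.CommutativeMonoid.Sum commutativeMonoid
    using (sum; sum-permute; sum-cong-≋; sum-replicate; ∑-distrib-+)
  open import Algebra.Properties.Monoid.Mult monoid using (_×_)
  open SetoidReasoning setoid

  -- Translation by x permutes the group, so it preserves the sum of all elements.
  order×x≈ε : ∀ {n} → Inverse setoid (≡.setoid (Fin n)) → ∀ x → n × x ≈ ε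
  order×x≈ε {n} G↔Fin x = identityʳ-unique (sum from) (n × x) (begin
    sum from ∙ n × x                    ≈⟨ ∙-congˡ (sum-replicate n) ⟨
    sum from ∙ sum {n} (λ _ → x)        ≈⟨ ∑-distrib-+ from (λ _ → x) ⟨
    sum (λ i → from i ∙ x)              ≈⟨ sum-cong-≋ {n} (λ i → from-to (from i ∙ x)) ⟨
    sum (λ i → from (to (from i ∙ x)))  ≈⟨ sum-permute from translation ⟨
    sum from                            ∎)
    where
    open Inverse G↔Fin using (to; from; to-cong)

    from-to : ∀ y → from (to y) ≈ y
    from-to = Inverse.strictlyInverseʳ G↔Fin

    to-from-via : ∀ {y} i → y ≈ from i → to y ≡ i
    to-from-via i y≈ = ≡.trans (to-cong y≈) (Inverse.strictlyInverseˡ G↔Fin i)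

    translation : Permutation′ n
    translation = permutation (λ i → to (from i ∙ x)) (λ i → to (from i - x))
      (λ i → to-from-via i (trans (∙-congʳ (from-to _)) (//-rightDividesˡ x (from i))))
      (λ i → to-from-via i (trans (∙-congʳ (from-to _)) (//-rightDividesʳ x (from i))))

-- Additivity of the Frobenius map in characteristic `p`.

module _ {a ℓ} (S : CommutativeSemiring a ℓ) where

  open CommutativeSemiring S
  open import Algebra.Properties.Semiring.Mult semiring
  open import Algebra.Properties.CommutativeSemiring.Exp S
  open import Algebra.Properties.CommutativeSemiring.Binomial S
    using (binomial; binomialTerm) renaming (theorem to binomialTheorem)
  open import Algebra.Properties.Semiring.Sum semiring
    using (sum; sum-cong-≋; sum-init-last; sum-replicate-zero)
  open SetoidReasoning setoid

  1^n≈1 : ∀ n → 1# ^ n ≈ 1#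
  1^n≈1 zero    = refl
  1^n≈1 (suc n) = trans (*-identityˡ _) (1^n≈1 n)

  ×1-homo-^ : ∀ m n → (m ℕ.^ n) × 1# ≈ (m × 1#) ^ n
  ×1-homo-^ m zero    = ×-homo-1 1#
  ×1-homo-^ m (suc n) = trans (×1-homo-* m (m ℕ.^ n)) (*-congˡ (×1-homo-^ m n))

  m∣n⇒n×x≈0 : ∀ {m n} → m × 1# ≈ 0# → m ∣ n → ∀ x → n × x ≈ 0#
  m∣n⇒n×x≈0 {m} m×1≈0 (divides-refl k) x = begin
    (k ℕ.* m) × x              ≈⟨ ×-congʳ (k ℕ.* m) (*-identityˡ x) ⟨
    (k ℕ.* m) × (1# * x)       ≈⟨ ×-assoc-* (k ℕ.* m) 1# x ⟨
    (k ℕ.* m) × 1# * x         ≈⟨ *-congʳ (×1-homo-* k m) ⟩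
    (k × 1# * m × 1#) * x      ≈⟨ *-congʳ (*-congˡ m×1≈0) ⟩
    (k × 1# * 0#) * x          ≈⟨ *-congʳ (zeroʳ _) ⟩
    0# * x                     ≈⟨ zeroˡ x ⟩
    0#                         ∎

  module _ {p} (p-prime : Prime p) (p×1≈0 : p × 1# ≈ 0#) where

    -- In the binomial expansion every coefficient strictly between the ends is a multiple of `p`,
    -- so only the two end terms survive.
    freshman's-dream : ∀ x y → (x + y) ^ p ≈ x ^ p + y ^ p
    freshman's-dream x y = helper p-prime p×1≈0
      where
      -- The prime is quantified afresh so that it can be split and the expansion indexed by
      -- `Fin (suc (suc n))`.
      helper : ∀ {p} → Prime p → p × 1# ≈ 0# → (x + y) ^ p ≈ x ^ p + y ^ p
      helper {zero}  p-prime _ = contradiction p-prime ¬prime[0]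
      helper {suc n} p-prime p×1≈0 = begin
        (x + y) ^ suc n
          ≈⟨ binomialTheorem (suc n) x y ⟩
        first + sum rest
          ≈⟨ +-cong first≈ (sum-init-last rest) ⟩
        y ^ suc n + (sum (rest ∘ inject₁) + rest (fromℕ n))
          ≈⟨ +-congˡ (+-cong (trans (sum-cong-≋ middle≈0) (sum-replicate-zero n)) last≈) ⟩
        y ^ suc n + (0# + x ^ suc n)
          ≈⟨ +-congˡ (+-identityˡ _) ⟩
        y ^ suc n + x ^ suc n
          ≈⟨ +-comm _ _ ⟩
        x ^ suc n + y ^ suc n  ∎
        where
        first = binomialTerm x y (suc n) Fin.zero
        rest : Fin (suc n) → Carrier
        rest i = binomialTerm x y (suc n) (Fin.suc i)

        first≈ : first ≈ y ^ suc n
        first≈ = trans (×-homo-1 _) (*-identityˡ _)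

        middle≈0 : ∀ i → rest (inject₁ i) ≈ 0#
        middle≈0 i = m∣n⇒n×x≈0 p×1≈0
          (prime⇒p∣pCk p-prime z<s
            (s<s (≡.subst (ℕ._< n) (≡.sym (Fin.toℕ-inject₁ i)) (Fin.toℕ<n i))))
          (binomial x y (suc n) (Fin.suc (inject₁ i)))

        last≈ : rest (fromℕ n) ≈ x ^ suc n
        last≈ rewrite Fin.toℕ-fromℕ n | nCn≡1 (suc n) | ℕ.n∸n≡0 n =
          trans (×-homo-1 _) (*-identityʳ _)

    ^-prime-power-homo-+ : ∀ k x y →
      (x + y) ^ (p ℕ.^ k) ≈ x ^ (p ℕ.^ k) + y ^ (p ℕ.^ k)
    ^-prime-power-homo-+ zero    x y = trans (*-identityʳ _)
      (sym (+-cong (*-identityʳ x) (*-identityʳ y)))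
    ^-prime-power-homo-+ (suc k) x y = begin
      (x + y) ^ (p ℕ.* r)              ≈⟨ ^-assocʳ (x + y) p r ⟨
      ((x + y) ^ p) ^ r                ≈⟨ ^-congˡ r (freshman's-dream x y) ⟩
      (x ^ p + y ^ p) ^ r              ≈⟨ ^-prime-power-homo-+ k (x ^ p) (y ^ p) ⟩
      (x ^ p) ^ r + (y ^ p) ^ r        ≈⟨ +-cong (^-assocʳ x p r) (^-assocʳ y p r) ⟩
      x ^ (p ℕ.* r) + y ^ (p ℕ.* r)    ∎
      where r = p ℕ.^ k

-- Multiples of 1 as fixed points of an additive power map.

module _ {a ℓ} (R : CommutativeRing a ℓ) where

  open CommutativeRing R
  open import Algebra.Properties.Semiring.Mult semiring using (_×_)
  open import Algebra.Properties.Semiring.Exp semiring using (_^_; ^-congˡ)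
  open import Algebra.Properties.Ring ring using (x+x≈x⇒x≈0)
  open SetoidReasoning setoid

  ^-fixes-×1 : ∀ n → (∀ x y → (x + y) ^ n ≈ x ^ n + y ^ n) →
               ∀ m → (m × 1#) ^ n ≈ m × 1#
  -- Additivity makes `0# ^ n` equal to its own double. This avoids a case split on `n`, where
  -- `0# ^ 0` would be `1#`.
  ^-fixes-×1 n homo zero = x+x≈x⇒x≈0 (0# ^ n) (begin
    0# ^ n + 0# ^ n  ≈⟨ homo 0# 0# ⟨
    (0# + 0#) ^ n    ≈⟨ ^-congˡ n (+-identityˡ 0#) ⟩
    0# ^ n           ∎)
  ^-fixes-×1 n homo (suc m) = trans (homo 1# (m × 1#))
    (+-cong (1^n≈1 commutativeSemiring n) (^-fixes-×1 n homo m))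

-- Powers, inverses and characteristic in a Heyting field.

module _ {c ℓ₁ ℓ₂} (F : HeytingField c ℓ₁ ℓ₂) where

  open HeytingField F
  open HeytingCommutativeRing heytingCommutativeRing using (commutativeRing)
  open CommutativeRing commutativeRing using
    (semiring; commutativeSemiring; +-abelianGroup; +-commutativeSemigroup)
  open import Algebra.Properties.CommutativeSemigroup +-commutativeSemigroup
    using (interchange)
  open import Algebra.Properties.AbelianGroup +-abelianGroup
    using (//-rightDividesˡ; identityʳ-unique)
  open import Algebra.Solver.Ring.NaturalCoefficients.Default commutativeSemiring
    using (solve; con; _:+_; _:*_; _:^_; _:=_)
  open import Algebra.Apartness.Properties.HeytingCommutativeRing heytingCommutativeRing
    using (1#0; x#0y#0→xy#0; x-0≈x)
  open import Algebra.Properties.Semiring.Mult semiring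
  open import Algebra.Properties.CommutativeSemiring.Exp commutativeSemiring
  open SetoidReasoning setoid

  -- By tightness it suffices to refute `x # 0#`; products of elements apart from zero stay apart
  -- from zero, hence so do powers.
  x^n≈0⇒x≈0 : ∀ {x} n → x ^ n ≈ 0# → x ≈ 0#
  x^n≈0⇒x≈0 {x} n x^n≈0 = proj₁ (tight x 0#) λ x#0 → proj₂ (tight _ _) x^n≈0 (x^n#0 x#0 n)
    where
    x^n#0 : x # 0# → ∀ n → x ^ n # 0#
    x^n#0 x#0 zero    = 1#0
    x^n#0 x#0 (suc n) = x#0y#0→xy#0 x#0 (x^n#0 x#0 n)

  x#0⇒∃x⁻¹ : ∀ {x} → x # 0# → ∃ λ x⁻¹ → x⁻¹ * x ≈ 1#
  x#0⇒∃x⁻¹ x#0 with #⇒invertible x#0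
  -- The inverse obtained from apartness is one of the difference `x - 0#`.
  ... | x⁻¹ , x⁻¹*x≈1 , _ = x⁻¹ , trans (*-congˡ (sym (x-0≈x _))) x⁻¹*x≈1

  -- The left side is the `n`-th power of `m × 1#`, and there are no nilpotents. This serves twice:
  -- to descend from the field order `q ^ 2` to `q`, and from `p ^ k` to the prime `p`.
  m^n×1≈0⇒m×1≈0 : ∀ m n → (m ℕ.^ n) × 1# ≈ 0# → m × 1# ≈ 0#
  m^n×1≈0⇒m×1≈0 m n eq =
    x^n≈0⇒x≈0 n (trans (sym (×1-homo-^ commutativeSemiring m n)) eq)

  ^q-homo-+ : ∀ {q} → IsPrimePower q → q × 1# ≈ 0# →
              ∀ x y → (x + y) ^ q ≈ x ^ q + y ^ q
  ^q-homo-+ (p , k , p-prime , _ , ≡.refl) p^k×1≈0 =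
    ^-prime-power-homo-+ commutativeSemiring p-prime (m^n×1≈0⇒m×1≈0 p k p^k×1≈0) k

  -- The polynomial as a function, and the case where `γ` is zero.

  module _ (q : ℕ) where

    open TraceOver F q hiding (_^_)

    Tr-cong : ∀ {x y} → x ≈ y → Tr x ≈ Tr y
    Tr-cong x≈y = +-cong x≈y (^-congˡ q x≈y)

    eval-X+γTrX² : ∀ γ x → eval (X +ₚ γ ∙ₚ Trₚ (X ^ₚ 2)) x ≈ x + γ * Tr (x ^ 2)
    eval-X+γTrX² γ x = begin
      eval (X +ₚ γ ∙ₚ Trₚ (X ^ₚ 2)) x
        ≈⟨ eval-+ X (γ ∙ₚ Trₚ (X ^ₚ 2)) x ⟩
      eval X x + eval (γ ∙ₚ Trₚ (X ^ₚ 2)) x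
        ≈⟨ +-cong (eval-X x) (eval-∙ γ (Trₚ (X ^ₚ 2)) x) ⟩
      x + γ * eval (Trₚ (X ^ₚ 2)) x
        ≈⟨ +-congˡ (*-congˡ (eval-Tr (X ^ₚ 2) x)) ⟩
      x + γ * Tr (eval (X ^ₚ 2) x)
        ≈⟨ +-congˡ (*-congˡ (Tr-cong (trans (eval-^ X 2 x) (^-congˡ 2 (eval-X x))))) ⟩
      x + γ * Tr (x ^ 2)  ∎

    γ≈0⇒isPermutation : ∀ {γ} → γ ≈ 0# → IsPermutationPolynomial (X +ₚ γ ∙ₚ Trₚ (X ^ₚ 2))
    γ≈0⇒isPermutation {γ} γ≈0 =
      (λ {x} {y} fx≈fy → trans (sym (f≈id x)) (trans fx≈fy (f≈id y))) ,
      (λ y → y , λ {x} x≈y → trans (f≈id x) x≈y)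
      where
      f≈id : ∀ x → eval (X +ₚ γ ∙ₚ Trₚ (X ^ₚ 2)) x ≈ x
      f≈id x = begin
        eval (X +ₚ γ ∙ₚ Trₚ (X ^ₚ 2)) x  ≈⟨ eval-X+γTrX² γ x ⟩
        x + γ * Tr (x ^ 2)               ≈⟨ +-congˡ (*-congʳ γ≈0) ⟩
        x + 0# * Tr (x ^ 2)              ≈⟨ +-congˡ (zeroˡ _) ⟩
        x + 0#                           ≈⟨ +-identityʳ x ⟩
        x                                ∎

    -- Two points with the same image when `γ` is nonzero.

    module _ (odd-prime-power : IsOddPrimePower q) (order : HasOrder F (q ℕ.^ 2)) where

      q×1≈0 : q × 1# ≈ 0#
      q×1≈0 = m^n×1≈0⇒m×1≈0 q 2 (order×x≈ε +-abelianGroup order 1#)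

      frobenius-homo-+ : ∀ x y → (x + y) ^ q ≈ x ^ q + y ^ q
      frobenius-homo-+ = ^q-homo-+ (proj₁ odd-prime-power) q×1≈0

      private
        q≡1+m+m : ∃ λ m → q ≡ suc (m ℕ.+ m)
        q≡1+m+m = 2∤n⇒n≡1+m+m (proj₂ odd-prime-power)

        m : ℕ
        m = proj₁ q≡1+m+m

      -- Taken as a multiple of 1, rather than through an inverse of 2, so that it is visibly fixed
      -- by the `q`-th power.
      -1/2# : Carrier
      -1/2# = m × 1#

      1-1/2-1/2≈0 : 1# + (-1/2# + -1/2#) ≈ 0#
      1-1/2-1/2≈0 = begin
        1# + (-1/2# + -1/2#)   ≈⟨ +-congˡ (×-homo-+ 1# m m) ⟨
        suc (m ℕ.+ m) × 1#     ≈⟨ ×-congˡ (proj₂ q≡1+m+m) ⟨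
        q × 1#                 ≈⟨ q×1≈0 ⟩
        0#                     ∎

      Tr[x-1/2] : ∀ x → Tr (x + -1/2#) ≈ Tr x + (-1/2# + -1/2#)
      Tr[x-1/2] x = begin
        (x + -1/2#) + (x + -1/2#) ^ q
          ≈⟨ +-congˡ (frobenius-homo-+ x -1/2#) ⟩
        (x + -1/2#) + (x ^ q + -1/2# ^ q)
          ≈⟨ +-congˡ (+-congˡ (^-fixes-×1 commutativeRing q frobenius-homo-+ m)) ⟩
        (x + -1/2#) + (x ^ q + -1/2#)
          ≈⟨ interchange x -1/2# (x ^ q) -1/2# ⟩
        Tr x + (-1/2# + -1/2#)  ∎

      -- The condition is 2yγ = −1/2 − γ²; multiplication by −1/2 serves as division by −2.
      ∃-quadratic-step : ∀ {γ} → γ # 0# → ∃ λ y → (y + γ) ^ 2 ≈ y ^ 2 + -1/2#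
      ∃-quadratic-step {γ} γ#0 with x#0⇒∃x⁻¹ γ#0
      ... | γ⁻¹ , γ⁻¹*γ≈1 = y , (begin
        (y + γ) ^ 2
          -- `y` is unfolded, so that the cross term 2yγ exposes the factor `γ⁻¹ * γ`; `w` stays a
          -- variable, which hides the subtraction from the semiring solver.
          ≈⟨ solve 4 (λ h i w g → (h :* (i :* w) :+ g) :^ 2 :=
                 (h :* (i :* w)) :^ 2 :+ ((i :* g) :* ((h :+ h) :* w) :+ g :^ 2))
               refl -1/2# γ⁻¹ w γ ⟩
        y ^ 2 + (γ⁻¹ * γ * ((-1/2# + -1/2#) * w) + γ ^ 2)
          -- Writing `γ ^ 2` as `w + -1/2#` lets all terms in `w` collect into a multiple of 1 + 2h,
          -- which vanishes.
          ≈⟨ +-congˡ (+-cong (trans (*-congʳ γ⁻¹*γ≈1) (*-identityˡ _))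
               (sym (//-rightDividesˡ -1/2# (γ ^ 2)))) ⟩
        y ^ 2 + ((-1/2# + -1/2#) * w + (w + -1/2#))
          ≈⟨ solve 3 (λ u h w → u :+ ((h :+ h) :* w :+ (w :+ h)) :=
                 (u :+ h) :+ (con 1 :+ (h :+ h)) :* w)
               refl (y ^ 2) -1/2# w ⟩
        (y ^ 2 + -1/2#) + (1# + (-1/2# + -1/2#)) * w
          ≈⟨ +-congˡ (*-congʳ 1-1/2-1/2≈0) ⟩
        (y ^ 2 + -1/2#) + 0# * w
          ≈⟨ trans (+-congˡ (zeroˡ w)) (+-identityʳ _) ⟩
        y ^ 2 + -1/2#  ∎)
        where
        w = γ ^ 2 - -1/2#
        y = -1/2# * (γ⁻¹ * w)

      collision : ∀ γ y → (y + γ) ^ 2 ≈ y ^ 2 + -1/2# →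
                  (y + γ) + γ * Tr ((y + γ) ^ 2) ≈ y + γ * Tr (y ^ 2)
      collision γ y eq = begin
        (y + γ) + γ * Tr ((y + γ) ^ 2)
          -- The trace changes by 2h = -1, so `γ` times the trace changes by -γ and cancels the
          -- shift of the argument.
          ≈⟨ +-congˡ (*-congˡ (trans (Tr-cong eq) (Tr[x-1/2] (y ^ 2)))) ⟩
        (y + γ) + γ * (Tr (y ^ 2) + (-1/2# + -1/2#))
          ≈⟨ solve 4 (λ y g t h → (y :+ g) :+ g :* (t :+ (h :+ h)) :=
                 (y :+ g :* t) :+ g :* (con 1 :+ (h :+ h)))
               refl y γ (Tr (y ^ 2)) -1/2# ⟩
        (y + γ * Tr (y ^ 2)) + γ * (1# + (-1/2# + -1/2#))
          ≈⟨ +-congˡ (*-congˡ 1-1/2-1/2≈0) ⟩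
        (y + γ * Tr (y ^ 2)) + γ * 0#
          ≈⟨ trans (+-congˡ (zeroʳ γ)) (+-identityʳ _) ⟩
        y + γ * Tr (y ^ 2)  ∎

      isPermutation⇒γ≈0 : ∀ {γ} → IsPermutationPolynomial (X +ₚ γ ∙ₚ Trₚ (X ^ₚ 2)) → γ ≈ 0#
      -- Tightness allows assuming `γ # 0#`, which supplies the inverse behind the collision.
      -- Injectivity then gives `y + γ ≈ y`, so `γ ≈ 0#`, a contradiction.
      isPermutation⇒γ≈0 {γ} (injective , _) = proj₁ (tight γ 0#) λ γ#0 →
        let y , eq = ∃-quadratic-step γ#0
            y+γ≈y = injective (begin
              eval (X +ₚ γ ∙ₚ Trₚ (X ^ₚ 2)) (y + γ)  ≈⟨ eval-X+γTrX² γ (y + γ) ⟩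
              (y + γ) + γ * Tr ((y + γ) ^ 2)         ≈⟨ collision γ y eq ⟩
              y + γ * Tr (y ^ 2)                     ≈⟨ eval-X+γTrX² γ y ⟨
              eval (X +ₚ γ ∙ₚ Trₚ (X ^ₚ 2)) y        ∎)
        in proj₂ (tight γ 0#) (identityʳ-unique y γ y+γ≈y) γ#0

open import Data.Nat using (ℕ; _^_)
open import Data.Product using (_×_)
open import Function.Bundles using (_⇔_)
open import Relation.Unary using (_≐_)

theorem3p2 : ∀ {c ℓ₁ ℓ₂} (q : ℕ) → IsOddPrimePower q →
    (F : HeytingField c ℓ₁ ℓ₂) → HasOrder F (q ^ 2) →
    let open HeytingField F
        open TraceOver F q
    in (∀ (γ : Carrier) → IsPermutationPolynomial (X +ₚ γ ∙ₚ Trₚ (X ^ₚ 2)) ⇔ (γ ≈ 0#))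
       × (P (X ^ₚ 2) ≐ ⟦ 0# ⟧)
theorem3p2 q odd-prime-power F order =
  -- Both predicates unfold to the two sides of the equivalence, so its directions are also the two
  -- inclusions.
  (λ γ → mk⇔ only-if if) , (λ {γ} → only-if {γ}) , (λ {γ} → if {γ})
  where
  only-if = isPermutation⇒γ≈0 F q odd-prime-power order
  if = γ≈0⇒isPermutation F q
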